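{- Let $k\geq 2$ be an integer, and for $n\ge 1$ let $P_{n,k}=B_k(n)/k^n$ be the probability that a uniformly random length-$n$ word over $\Sigma_k$ has a unique border, where $B_k(n)$ is the number of length-$n$ words over $\Sigma_k$ with a unique border. Then the limit $P_k=\lim_{n\to\infty}P_{n,k}$ exists.
   Context: $\Sigma_k=\{0,1,\ldots,k-1\}$. A border of a word $w$ is a non-empty word that is both a proper prefix and a proper suffix of $w$. A word has a unique border if it has exactly one border. -}

module Defs where

open import Data.Fin.Base using (Fin)
import Data.Fin.Properties as Fin
open import Data.Integer.Base using (+_)
open import Data.List.Base
  using (List; []; _∷_; [_]; length; filter; allFin; cartesianProductWith; inits)
open import Data.List.Membership.Propositional using (_∈_; find; lose)
open import Data.List.Membership.Propositional.Properties using (∈-map⁺)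
import Data.List.Properties as List
open import Data.List.Relation.Binary.Prefix.Heterogeneous using (Prefix; []; _∷_)
open import Data.List.Relation.Binary.Prefix.Heterogeneous.Properties using (prefix?)
open import Data.List.Relation.Binary.Suffix.Heterogeneous using (Suffix)
open import Data.List.Relation.Binary.Suffix.Heterogeneous.Properties using (suffix?)
open import Data.List.Relation.Unary.All as All using (All; all?)
open import Data.List.Relation.Unary.Any using (Any; here; there; any?)
open import Data.Nat.Base using (ℕ; zero; suc; NonZero; _^_; _≥_)
open import Data.Nat.Properties using (m^n≢0)
open import Data.Product using (∃!; ∃-syntax; _×_; _,_)
open import Data.Rational.Base using (ℚ; Positive; _/_; _+_; _-_; ∣_∣; _≤_)
open import Relation.Binary.Definitions using (DecidableEquality)
open import Relation.Binary.PropositionalEquality using (_≡_; _≢_; refl)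
open import Relation.Nullary.Decidable using (Dec; map′; ¬?; _×-dec_; _→-dec_)

private
  variable
    k : ℕ

Word : ℕ → Set
Word k = List (Fin k)

ProperPrefix ProperSuffix : Word k → Word k → Set
ProperPrefix u w = Prefix _≡_ u w × u ≢ w
ProperSuffix u w = Suffix _≡_ u w × u ≢ w

IsBorder : Word k → Word k → Set
IsBorder u w = u ≢ [] × ProperPrefix u w × ProperSuffix u w

HasUniqueBorder : Word k → Set
HasUniqueBorder w = ∃! _≡_ λ u → IsBorder u w

_≟ʷ_ : DecidableEquality (Word k)
_≟ʷ_ = List.≡-dec Fin._≟_

isBorder? : (u w : Word k) → Dec (IsBorder u w)
isBorder? u w =
  ¬? (u ≟ʷ []) ×-dec
  (prefix? Fin._≟_ u w ×-dec ¬? (u ≟ʷ w)) ×-dec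
  (suffix? Fin._≟_ u w ×-dec ¬? (u ≟ʷ w))

prefix⇒∈inits : {u w : Word k} → Prefix _≡_ u w → u ∈ inits w
prefix⇒∈inits []              = here refl
prefix⇒∈inits {w = x ∷ _} (refl ∷ p) with prefix⇒∈inits p
... | here refl = there (here refl)
... | there u∈  = there (there (∈-map⁺ (x ∷_) u∈))

hasUniqueBorder? : (w : Word k) → Dec (HasUniqueBorder w)
hasUniqueBorder? {k} w = map′ to from (any? unique? (inits w))
  where
  border∈inits : ∀ {u} → IsBorder u w → u ∈ inits w
  border∈inits (_ , (p , _) , _) = prefix⇒∈inits p

  Unique : Word k → Set
  Unique u = IsBorder u w × All (λ v → IsBorder v w → u ≡ v) (inits w)

  unique? : (u : Word k) → Dec (Unique u)
  unique? u =
    isBorder? u w ×-dec all? (λ v → isBorder? v w →-dec (u ≟ʷ v)) (inits w)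

  to : Any Unique (inits w) → HasUniqueBorder w
  to any with find any
  ... | u , _ , b , uniq = u , b , λ bv → All.lookup uniq (border∈inits bv) bv

  from : HasUniqueBorder w → Any Unique (inits w)
  from (u , b , uniq) = lose (border∈inits b) (b , All.tabulate λ _ → uniq)

-- Every word of length n over Fin k, listed exactly once.
words : (k n : ℕ) → List (Word k)
words k zero    = [ [] ]
words k (suc n) = cartesianProductWith _∷_ (allFin k) (words k n)

B : (k n : ℕ) → ℕ
B k n = length (filter hasUniqueBorder? (words k n))

P : (k : ℕ) .{{_ : NonZero k}} → ℕ → ℚ
P k n = _/_ (+ B k n) (k ^ n) {{m^n≢0 k n}}

-- Bishop's real numbers: a real is a regular sequence of rationals, the m-th
-- term being within 1/(m+1) of the real it represents.
record ℝ : Set where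
  field
    approx  : ℕ → ℚ
    regular : ∀ m n → ∣ approx m - approx n ∣ ≤ + 1 / suc m + + 1 / suc n

-- ∣ q - x ∣ ≤ ε for a real x; the extra 1/(m+1) is the error of the m-th
-- approximation, so no slack remains in the limit.
∣_-_∣≤_ : ℚ → ℝ → ℚ → Set
∣ q - x ∣≤ ε = ∀ m → ∣ q - ℝ.approx x m ∣ ≤ ε + + 1 / suc m

ConvergesTo : (ℕ → ℚ) → ℝ → Set
ConvergesTo a x =
  ∀ ε → Positive ε → ∃[ N ] (∀ n → n ≥ N → ∣ a n - x ∣≤ ε)

{-# OPTIONS --safe #-}

-- For |p| = m ≤ |s|, the borders of length at most m of a word p ++ y ++ s
-- depend only on p and s.  A border drop d w of a word w is determined by the
-- first d letters of w, so at most Σ_{d<e} k^d ≤ k^e words of length m + e have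
-- a border longer than m.  Hence P k n and P k n' differ by at most 2 / k^m
-- whenever n, n' ≥ 2m, and P k is a Cauchy sequence with an explicit modulus.
module Submission where

open import Defs
open import Data.Nat.Base using (ℕ; NonZero; _≤_)
open import Data.Product using (∃)

open import Algebra.Properties.AbelianGroup using (xyx⁻¹≈y)
open import Algebra.Properties.Group using (⁻¹-anti-homo-//)
import Data.Integer.Base as ℤ
import Data.Integer.Properties as ℤ
open import Data.List.Base
  using (List; []; _∷_; _++_; map; length; filter; take; drop; allFin; cartesianProductWith)
open import Data.List.Membership.Propositional using (_∈_)
open import Data.List.Membership.Propositional.Properties using (∈-cartesianProductWith⁻)
import Data.List.Properties as List
open import Data.List.Relation.Binary.Pointwise using (Pointwise-≡⇒≡; Pointwise-length)
open import Data.List.Relation.Binary.Prefix.Heterogeneous using (Prefix; []; _∷_)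
open import Data.List.Relation.Binary.Suffix.Heterogeneous using (Suffix; here; there; _++ˢ_)
import Data.List.Relation.Binary.Suffix.Heterogeneous.Properties as Suffix
import Data.List.Relation.Unary.All as All
open import Data.List.Relation.Unary.Any using (here; there)
open import Data.List.Relation.Unary.AllPairs using ([]; _∷_)
open import Data.List.Relation.Unary.Unique.Propositional using (Unique)
import Data.List.Relation.Unary.Unique.Propositional.Properties as Unique
open import Data.Nat.Base using (zero; suc; _+_; _*_; _∸_; _^_; _⊓_; _<_; z≤n; s≤s; s≤s⁻¹)
open import Data.Nat.ListAction using (sum)
open import Data.Nat.ListAction.Properties using (sum-++)
open import Data.Nat.Properties
open import Data.Nat.Tactic.RingSolver using (solve-∀)
open import Data.Product using (_,_)
open import Data.Rational.Base as ℚ using (ℚ; mkℚ; _/_)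
import Data.Rational.Properties as ℚ
open import Data.Rational.Unnormalised.Base as ℚᵘ using (mkℚᵘ; *≤*)
import Data.Rational.Unnormalised.Properties as ℚᵘ
open import Data.Sum.Base using (inj₁; inj₂; [_,_]′)
open import Function.Base using (_∘_)
open import Relation.Binary.PropositionalEquality
open import Relation.Nullary.Decidable using (Dec; yes; no)
open import Relation.Nullary.Negation using (contradiction)

private
  variable
    A C D : Set
    k : ℕ

-- Finite sums over lists and indicator functions.

∑ : List A → (A → ℕ) → ℕ
∑ xs f = sum (map f xs)

∑-cong : (xs : List A) {f g : A → ℕ} → (∀ x → f x ≡ g x) → ∑ xs f ≡ ∑ xs g
∑-cong xs f≗g = cong sum (List.map-cong f≗g xs)

∑-mono : (xs : List A) {f g : A → ℕ} → (∀ {x} → x ∈ xs → f x ≤ g x) → ∑ xs f ≤ ∑ xs g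
∑-mono []       f≤g = z≤n
∑-mono (x ∷ xs) f≤g = +-mono-≤ (f≤g (here refl)) (∑-mono xs (f≤g ∘ there))

∑-+ : (xs : List A) (f g : A → ℕ) → ∑ xs (λ x → f x + g x) ≡ ∑ xs f + ∑ xs g
∑-+ []       f g = refl
∑-+ (x ∷ xs) f g rewrite ∑-+ xs f g = interchange (f x) (g x) (∑ xs f) (∑ xs g)
  where
  interchange : ∀ a b c d → (a + b) + (c + d) ≡ (a + c) + (b + d)
  interchange = solve-∀

∑-*ˡ : (xs : List A) (c : ℕ) (f : A → ℕ) → ∑ xs (λ x → c * f x) ≡ c * ∑ xs f
∑-*ˡ []       c f = sym (*-zeroʳ c)
∑-*ˡ (x ∷ xs) c f rewrite ∑-*ˡ xs c f = sym (*-distribˡ-+ c (f x) (∑ xs f))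

∑-const : (xs : List A) (c : ℕ) → ∑ xs (λ _ → c) ≡ length xs * c
∑-const []       c = refl
∑-const (x ∷ xs) c = cong (c +_) (∑-const xs c)

∑-++ : (xs ys : List A) (f : A → ℕ) → ∑ (xs ++ ys) f ≡ ∑ xs f + ∑ ys f
∑-++ xs ys f = trans (cong sum (List.map-++ f xs ys)) (sum-++ (map f xs) (map f ys))

∑-cartesianProductWith : (g : A → C → D) (xs : List A) (ys : List C) (f : D → ℕ) →
  ∑ (cartesianProductWith g xs ys) f ≡ ∑ xs (λ x → ∑ ys (λ y → f (g x y)))
∑-cartesianProductWith g []       ys f = refl
∑-cartesianProductWith g (x ∷ xs) ys f =
  trans (∑-++ (map (g x) ys) (cartesianProductWith g xs ys) f)
        (cong₂ _+_ (cong sum (sym (List.map-∘ ys))) (∑-cartesianProductWith g xs ys f))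

⟦_⟧ : Dec A → ℕ
⟦ yes _ ⟧ = 1
⟦ no _ ⟧  = 0

⟦⟧≤1 : (a? : Dec A) → ⟦ a? ⟧ ≤ 1
⟦⟧≤1 (yes _) = ≤-refl
⟦⟧≤1 (no _)  = z≤n

⟦⟧-mono : (a? : Dec A) (c? : Dec C) → (A → C) → ⟦ a? ⟧ ≤ ⟦ c? ⟧
⟦⟧-mono (no _)  _       _   = z≤n
⟦⟧-mono (yes _) (yes _) _   = ≤-refl
⟦⟧-mono (yes a) (no ¬c) a→c = contradiction (a→c a) ¬c

1≤⟦⟧ : (a? : Dec A) → A → 1 ≤ ⟦ a? ⟧
1≤⟦⟧ (yes _) _ = ≤-refl
1≤⟦⟧ (no ¬a) a = contradiction a ¬a

module _ {Q : A → Set} (Q? : ∀ x → Dec (Q x)) where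

  length-filter≡∑ : ∀ xs → length (filter Q? xs) ≡ ∑ xs (λ x → ⟦ Q? x ⟧)
  length-filter≡∑ []       = refl
  length-filter≡∑ (x ∷ xs) with Q? x
  ... | yes _ = cong suc (length-filter≡∑ xs)
  ... | no _  = length-filter≡∑ xs

  -- Once an entry satisfies `Q`, a later one doing so would equal it, which distinctness of the
  -- entries forbids; hence all later terms vanish.
  ∑⟦⟧≤1 : ∀ {xs} → Unique xs → (∀ {x y} → x ∈ xs → y ∈ xs → Q x → Q y → x ≡ y) →
          ∑ xs (λ x → ⟦ Q? x ⟧) ≤ 1
  ∑⟦⟧≤1 []                       _    = z≤n
  ∑⟦⟧≤1 {x ∷ xs} (x∉xs ∷ unique) same with Q? x
  ... | no _   = ∑⟦⟧≤1 unique λ x∈ y∈ → same (there x∈) (there y∈)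
  ... | yes Qx = s≤s (≤-trans (∑-mono xs vanish)
                       (≤-reflexive (trans (∑-const xs 0) (*-zeroʳ (length xs)))))
    where
    vanish : ∀ {y} → y ∈ xs → ⟦ Q? y ⟧ ≤ 0
    vanish {y} y∈ with Q? y
    ... | no _   = z≤n
    ... | yes Qy = contradiction (same (here refl) (there y∈) Qx Qy) (All.lookup x∉xs y∈)

-- Sums over all words of a given length.

∈-words⇒length : ∀ n {w : Word k} → w ∈ words k n → length w ≡ n
∈-words⇒length zero    (here refl) = refl
∈-words⇒length (suc n) w∈ with ∈-cartesianProductWith⁻ _∷_ (allFin _) (words _ n) w∈
... | _ , _ , _ , v∈ , refl = cong suc (∈-words⇒length n v∈)

words-unique : ∀ k n → Unique (words k n)
words-unique k zero    = All.[] ∷ []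
words-unique k (suc n) =
  Unique.cartesianProductWith⁺ _∷_ List.∷-injective (Unique.allFin⁺ k) (words-unique k n)

∑-words-suc : ∀ k n (f : Word k → ℕ) →
  ∑ (words k (suc n)) f ≡ ∑ (allFin k) (λ x → ∑ (words k n) (f ∘ (x ∷_)))
∑-words-suc k n f = ∑-cartesianProductWith _∷_ (allFin k) (words k n) f

∑-allFin-const : ∀ k c → ∑ (allFin k) (λ _ → c) ≡ k * c
∑-allFin-const k c = trans (∑-const (allFin k) c) (cong (_* c) (List.length-tabulate {n = k} _))

∑-words-const : ∀ k n c → ∑ (words k n) (λ _ → c) ≡ k ^ n * c
∑-words-const k zero    c = refl
∑-words-const k (suc n) c = begin
  ∑ (words k (suc n)) (λ _ → c)                      ≡⟨ ∑-words-suc k n _ ⟩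
  ∑ (allFin k) (λ _ → ∑ (words k n) (λ _ → c))       ≡⟨ ∑-allFin-const k _ ⟩
  k * ∑ (words k n) (λ _ → c)                        ≡⟨ cong (k *_) (∑-words-const k n c) ⟩
  k * (k ^ n * c)                                    ≡⟨ *-assoc k (k ^ n) c ⟨
  k ^ suc n * c                                      ∎
  where open ≡-Reasoning

∑-words-++ : ∀ m n (f : Word k → ℕ) →
  ∑ (words k (m + n)) f ≡ ∑ (words k m) (λ p → ∑ (words k n) (λ r → f (p ++ r)))
∑-words-++ zero    n f = sym (+-identityʳ _)
∑-words-++ {k} (suc m) n f = begin
  ∑ (words k (suc m + n)) f
    ≡⟨ ∑-words-suc k (m + n) f ⟩
  ∑ (allFin k) (λ x → ∑ (words k (m + n)) (f ∘ (x ∷_)))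
    ≡⟨ ∑-cong (allFin k) (λ x → ∑-words-++ m n (f ∘ (x ∷_))) ⟩
  ∑ (allFin k) (λ x → ∑ (words k m) (λ p → ∑ (words k n) (λ r → f (x ∷ p ++ r))))
    ≡⟨ ∑-words-suc k m _ ⟨
  ∑ (words k (suc m)) (λ p → ∑ (words k n) (λ r → f (p ++ r)))
    ∎
  where open ≡-Reasoning

∑-words-drop : ∀ t n (f : Word k → ℕ) →
  ∑ (words k (t + n)) (f ∘ drop t) ≡ k ^ t * ∑ (words k n) f
∑-words-drop {k} t n f = begin
  ∑ (words k (t + n)) (f ∘ drop t)                       ≡⟨ go t ⟩
  ∑ (words k t) (λ _ → ∑ (words k n) f)                  ≡⟨ ∑-words-const k t _ ⟩
  k ^ t * ∑ (words k n) f                                ∎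
  where
  open ≡-Reasoning
  -- The factor `k ^ t` is kept as a constant sum over `words k t`, so that both sides unfold one
  -- letter at a time by `∑-words-suc`.
  go : ∀ t → ∑ (words k (t + n)) (f ∘ drop t) ≡ ∑ (words k t) (λ _ → ∑ (words k n) f)
  go zero    = sym (+-identityʳ _)
  go (suc t) = trans (∑-words-suc k (t + n) _)
                 (trans (∑-cong (allFin k) (λ _ → go t)) (sym (∑-words-suc k t _)))

-- Relates words of two different lengths while preserving both ends, the only parts that short
-- borders see.
cut : ℕ → ℕ → Word k → Word k
cut m t w = take m w ++ drop t (drop m w)

-- Each word of length `m + n` is the cut of exactly `k ^ t` longer words, one for each choice of
-- the deleted block.
∑-words-cut : ∀ m t n (f : Word k → ℕ) →
  ∑ (words k (m + (t + n))) (f ∘ cut m t) ≡ k ^ t * ∑ (words k (m + n)) f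
∑-words-cut zero    t n f = ∑-words-drop t n f
∑-words-cut {k} (suc m) t n f = begin
  ∑ (words k (suc m + (t + n))) (f ∘ cut (suc m) t)
    ≡⟨ ∑-words-suc k (m + (t + n)) _ ⟩
  ∑ (allFin k) (λ x → ∑ (words k (m + (t + n))) (f ∘ (x ∷_) ∘ cut m t))
    ≡⟨ ∑-cong (allFin k) (λ x → ∑-words-cut m t n (f ∘ (x ∷_))) ⟩
  ∑ (allFin k) (λ x → k ^ t * ∑ (words k (m + n)) (f ∘ (x ∷_)))
    ≡⟨ ∑-*ˡ (allFin k) (k ^ t) _ ⟩
  k ^ t * ∑ (allFin k) (λ x → ∑ (words k (m + n)) (f ∘ (x ∷_)))
    ≡⟨ cong (k ^ t *_) (∑-words-suc k (m + n) f) ⟨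
  k ^ t * ∑ (words k (suc m + n)) f
    ∎
  where open ≡-Reasoning

-- Prefixes, suffixes and words matching their own shift.

prefix-++⁻ : ∀ {u : Word k} p {z} → length u ≤ length p → Prefix _≡_ u (p ++ z) → Prefix _≡_ u p
prefix-++⁻ {u = []}    _       _   _         = []
prefix-++⁻ {u = _ ∷ _} (_ ∷ p) u≤p (e ∷ pre) = e ∷ prefix-++⁻ p (s≤s⁻¹ u≤p) pre

prefix-++⁺ : ∀ {u p : Word k} {z} → Prefix _≡_ u p → Prefix _≡_ u (p ++ z)
prefix-++⁺ []        = []
prefix-++⁺ (e ∷ pre) = e ∷ prefix-++⁺ pre

suffix-++⁻ : ∀ {u : Word k} z {s} → length u ≤ length s → Suffix _≡_ u (z ++ s) → Suffix _≡_ u s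
suffix-++⁻ []      _   suf         = suf
suffix-++⁻ (_ ∷ z) u≤s (there suf) = suffix-++⁻ z u≤s suf
-- In this case `u` would be all of `c ∷ z ++ s`, which is strictly longer than `s`.
suffix-++⁻ {u = u} (c ∷ z) {s} u≤s (here eq) = contradiction u≤s (<⇒≱ (begin-strict
  length s                  <⟨ m≤n+m (suc (length s)) (length z) ⟩
  length z + suc (length s) ≡⟨ +-suc (length z) (length s) ⟩
  suc (length z + length s) ≡⟨ List.length-++ (c ∷ z) ⟨
  length (c ∷ z ++ s)       ≡⟨ Pointwise-length eq ⟨
  length u                  ∎))
  where open ≤-Reasoning

-- A suffix is determined by its length, so borders can be indexed by the number of letters in front
-- of them.
suffix⇒drop : ∀ {u w : Word k} → Suffix _≡_ u w → u ≡ drop (length w ∸ length u) w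
suffix⇒drop {u = u} {w} (here eq) with Pointwise-≡⇒≡ eq
... | refl rewrite n∸n≡0 (length u) = refl
suffix⇒drop {u = u} {c ∷ w} (there suf) rewrite +-∸-assoc 1 (Suffix.length-mono suf) =
  suffix⇒drop suf

-- Matching the first letters of r and p leaves the same situation for the
-- tail of r and the rotation of p.
prefix-of-shift-unique : ∀ p {r r′ : Word k} → p ≢ [] → length r ≡ length r′ →
  Prefix _≡_ r (p ++ r) → Prefix _≡_ r′ (p ++ r′) → r ≡ r′
prefix-of-shift-unique [] p≢[] _ _ _ = contradiction refl p≢[]
prefix-of-shift-unique (x ∷ p) {[]} {[]} _ _ _ _ = refl
prefix-of-shift-unique (x ∷ p) {_ ∷ r} {_ ∷ r′} _ r~r′ (refl ∷ pre) (refl ∷ pre′) =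
  cong (x ∷_) (prefix-of-shift-unique (p ++ x ∷ []) rotation≢[] (suc-injective r~r′)
    (rotate r pre) (rotate r′ pre′))
  where
  rotation≢[] : p ++ x ∷ [] ≢ []
  rotation≢[] eq with () ← List.++-conicalʳ p (x ∷ []) eq
  rotate : ∀ q → Prefix _≡_ q (p ++ x ∷ q) → Prefix _≡_ q ((p ++ x ∷ []) ++ q)
  rotate q = subst (Prefix _≡_ q) (sym (List.++-assoc p (x ∷ []) q))

-- Counting words with long borders.

drop-length-++ : (p r : List A) → drop (length p) (p ++ r) ≡ r
drop-length-++ []      r = refl
drop-length-++ (_ ∷ p) r = drop-length-++ p r

-- Fix the first `d` letters `p`. The border condition makes the remainder `r` a prefix of `p ++ r`,
-- and `prefix-of-shift-unique` leaves at most one such `r`. Each of the `k ^ d` choices of `p`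
-- therefore contributes at most 1.
∑-border-drop≤ : ∀ k d n → ∑ (words k (d + n)) (λ w → ⟦ isBorder? (drop d w) w ⟧) ≤ k ^ d
∑-border-drop≤ k d n = begin
  ∑ (words k (d + n)) (λ w → ⟦ isBorder? (drop d w) w ⟧)
    ≡⟨ ∑-words-++ d n _ ⟩
  ∑ (words k d) (λ p → ∑ (words k n) (λ r → ⟦ isBorder? (drop d (p ++ r)) (p ++ r) ⟧))
    ≤⟨ ∑-mono (words k d) (λ {p} p∈ → ∑⟦⟧≤1 (λ r → isBorder? (drop d (p ++ r)) (p ++ r))
         (words-unique k n) (same (∈-words⇒length d p∈))) ⟩
  ∑ (words k d) (λ _ → 1)
    ≡⟨ ∑-words-const k d 1 ⟩
  k ^ d * 1
    ≡⟨ *-identityʳ (k ^ d) ⟩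
  k ^ d
    ∎
  where
  open ≤-Reasoning
  same : ∀ {p r r′} → length p ≡ d → r ∈ words k n → r′ ∈ words k n →
         IsBorder (drop d (p ++ r)) (p ++ r) → IsBorder (drop d (p ++ r′)) (p ++ r′) → r ≡ r′
  same {p} {r} {r′} refl r∈ r′∈ b b′
    rewrite drop-length-++ p r | drop-length-++ p r′
    with _ , (pre , r≢) , _ ← b | _ , (pre′ , _) , _ ← b′ =
    -- An empty `p` would make `r` the whole word, against its being a proper prefix.
    prefix-of-shift-unique p (λ { refl → r≢ refl })
      (trans (∈-words⇒length n r∈) (sym (∈-words⇒length n r′∈))) pre pre′

-- Counts the borders of w longer than length w ∸ e.
longBorders : ℕ → Word k → ℕ
longBorders zero    w = 0
longBorders (suc e) w = longBorders e w + ⟦ isBorder? (drop e w) w ⟧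

1≤longBorders : ∀ {e d} {w : Word k} → d < e → IsBorder (drop d w) w → 1 ≤ longBorders e w
1≤longBorders {e = suc e} {d} {w} d<1+e b with m≤n⇒m<n∨m≡n (s≤s⁻¹ d<1+e)
... | inj₁ d<e  = m≤n⇒m≤n+o _ (1≤longBorders d<e b)
... | inj₂ refl = m≤n⇒m≤o+n (longBorders e w) (1≤⟦⟧ (isBorder? (drop e w) w) b)

-- A border longer than `m` has fewer than `e` letters in front of it, so it is one of those that
-- `longBorders e` counts.
longBorders≡0⇒short : ∀ m {e} {v w : Word k} → length w ≡ m + e → longBorders e w ≡ 0 →
  IsBorder v w → length v ≤ m
longBorders≡0⇒short m {e} {v} {w} |w| none b@(_ , _ , (suf , _)) = ≮⇒≥ λ m<v →
  <⇒≱ (1≤longBorders (d<e m<v) (subst (λ u → IsBorder u w) (suffix⇒drop suf) b))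
      (≤-reflexive none)
  where
  open ≤-Reasoning
  d<e : m < length v → length w ∸ length v < e
  d<e m<v = +-cancelˡ-< (length v) _ _ (begin-strict
    length v + (length w ∸ length v) ≡⟨ m+[n∸m]≡n (Suffix.length-mono suf) ⟩
    length w                         ≡⟨ |w| ⟩
    m + e                            <⟨ +-monoˡ-< e m<v ⟩
    length v + e                     ∎)

-- This is the geometric sum of the bounds `k ^ d` for `d < e`. The induction closes because
-- `k ^ e + k ^ e ≤ k ^ suc e` when `2 ≤ k`.
∑-longBorders≤ : ∀ k n e → 2 ≤ k → e ≤ n → ∑ (words k n) (longBorders e) ≤ k ^ e
∑-longBorders≤ k n zero    _   _   =
  ≤-trans (≤-reflexive (trans (∑-words-const k n 0) (*-zeroʳ (k ^ n)))) z≤n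
∑-longBorders≤ k n (suc e) 2≤k e<n = begin
  ∑ (words k n) (longBorders (suc e))
    ≡⟨ ∑-+ (words k n) _ _ ⟩
  ∑ (words k n) (longBorders e) + ∑ (words k n) (λ w → ⟦ isBorder? (drop e w) w ⟧)
    ≤⟨ +-mono-≤ (∑-longBorders≤ k n e 2≤k (<⇒≤ e<n)) last≤ ⟩
  k ^ e + k ^ e
    ≡⟨ cong (k ^ e +_) (+-identityʳ (k ^ e)) ⟨
  2 * k ^ e
    ≤⟨ *-monoˡ-≤ (k ^ e) 2≤k ⟩
  k ^ suc e
    ∎
  where
  open ≤-Reasoning
  last≤ : ∑ (words k n) (λ w → ⟦ isBorder? (drop e w) w ⟧) ≤ k ^ e
  last≤ = subst (λ n → ∑ (words k n) (λ w → ⟦ isBorder? (drop e w) w ⟧) ≤ k ^ e)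
                (m+[n∸m]≡n (<⇒≤ e<n)) (∑-border-drop≤ k e (n ∸ e))

-- Replacing the middle of a word.

short-border-transfer : ∀ {u : Word k} p s y y′ → length u ≤ length p → length u ≤ length s →
  IsBorder u (p ++ y ++ s) → IsBorder u (p ++ y′ ++ s)
short-border-transfer {k} {u} p s y y′ u≤p u≤s (u≢[] , (pre , _) , (suf , _)) =
  -- By its length, `u` already fits into `p` as a prefix and into `s` as a suffix, so the middle is
  -- never consulted.
  u≢[] , (prefix-++⁺ (prefix-++⁻ p u≤p pre) , u≢w) ,
  (p ++ˢ (y′ ++ˢ suffix-++⁻ y u≤s (suffix-++⁻ p (≤-trans u≤s (s≤ y)) suf)) , u≢w)
  where
  open ≤-Reasoning
  s≤ : ∀ z → length s ≤ length (z ++ s)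
  s≤ z = ≤-trans (m≤n+m _ (length z)) (≤-reflexive (sym (List.length-++ z)))
  length≡0⇒≡[] : ∀ {v : Word k} → length v ≡ 0 → v ≡ []
  length≡0⇒≡[] {[]} _ = refl
  -- The new word is at least twice as long as the non-empty `u`, so the border stays proper.
  u≢w : u ≢ p ++ y′ ++ s
  u≢w u≡w = u≢[] (length≡0⇒≡[] (n≤0⇒n≡0 (+-cancelˡ-≤ (length u) _ _ (begin
    length u + length u            ≤⟨ +-mono-≤ u≤p (≤-trans u≤s (s≤ y′)) ⟩
    length p + length (y′ ++ s)    ≡⟨ List.length-++ p ⟨
    length (p ++ y′ ++ s)          ≡⟨ cong length u≡w ⟨
    length u                       ≡⟨ +-identityʳ _ ⟨
    length u + 0                   ∎))))

-- With no long borders on either side, all borders are short and the two words have the same ones.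
-- Existence is carried from the first word to the second; for uniqueness, borders of the second are
-- carried back.
uniqueBorder-transfer : ∀ (p s : Word k) y y′ → length p ≤ length s →
  longBorders (length (y ++ s)) (p ++ y ++ s) ≡ 0 →
  longBorders (length (y′ ++ s)) (p ++ y′ ++ s) ≡ 0 →
  HasUniqueBorder (p ++ y ++ s) → HasUniqueBorder (p ++ y′ ++ s)
uniqueBorder-transfer p s y y′ p≤s none none′ (u , b , uniq) =
  u , short-border-transfer p s y y′ u≤p (≤-trans u≤p p≤s) b ,
  λ b′ → let v≤p = longBorders≡0⇒short (length p) (List.length-++ p) none′ b′ in
         uniq (short-border-transfer p s y′ y v≤p (≤-trans v≤p p≤s) b′)
  where
  u≤p = longBorders≡0⇒short (length p) (List.length-++ p) none b

unique : Word k → ℕ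
unique w = ⟦ hasUniqueBorder? w ⟧

-- If either word has a long border, the error term is at least 1 and dominates any indicator.
-- Otherwise `uniqueBorder-transfer` applies and no error is incurred.
unique-transfer : ∀ (p s : Word k) y y′ → length p ≤ length s →
  unique (p ++ y ++ s) ≤ unique (p ++ y′ ++ s) +
    (longBorders (length (y ++ s)) (p ++ y ++ s) + longBorders (length (y′ ++ s)) (p ++ y′ ++ s))
unique-transfer p s y y′ p≤s
  with longBorders (length (y ++ s)) (p ++ y ++ s) in eq
     | longBorders (length (y′ ++ s)) (p ++ y′ ++ s) in eq′
... | suc _ | _     = m≤n⇒m≤o+n (unique (p ++ y′ ++ s))
                        (≤-trans (⟦⟧≤1 (hasUniqueBorder? (p ++ y ++ s))) (s≤s z≤n))
... | zero  | suc _ = m≤n⇒m≤o+n (unique (p ++ y′ ++ s))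
                        (≤-trans (⟦⟧≤1 (hasUniqueBorder? (p ++ y ++ s))) (s≤s z≤n))
... | zero  | zero  = m≤n⇒m≤n+o 0
                        (⟦⟧-mono (hasUniqueBorder? (p ++ y ++ s)) (hasUniqueBorder? (p ++ y′ ++ s))
                          (uniqueBorder-transfer p s y y′ p≤s eq eq′))

-- Comparing the counts for two lengths.

B≡∑ : ∀ k n → B k n ≡ ∑ (words k n) unique
B≡∑ k n = length-filter≡∑ hasUniqueBorder? (words k n)

module _ (k : ℕ) (2≤k : 2 ≤ k) {m b : ℕ} (m≤b : m ≤ b) (t : ℕ) where

  private
    W = words k (m + (t + b))

    errors : Word k → ℕ
    errors w = longBorders b (cut m t w) + longBorders (t + b) w

    -- Each summand costs at most `k ^ (t + b)`: for the cut words the total is at most `k ^ b`, and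
    -- each of them is hit `k ^ t` times.
    ∑-errors≤ : ∑ W errors ≤ 2 * k ^ (t + b)
    ∑-errors≤ = begin
      ∑ W errors
        ≡⟨ ∑-+ W (longBorders b ∘ cut m t) (longBorders (t + b)) ⟩
      ∑ W (longBorders b ∘ cut m t) + ∑ W (longBorders (t + b))
        ≡⟨ cong (_+ ∑ W (longBorders (t + b))) (∑-words-cut m t b (longBorders b)) ⟩
      k ^ t * ∑ (words k (m + b)) (longBorders b) + ∑ W (longBorders (t + b))
        ≤⟨ +-mono-≤ (*-monoʳ-≤ (k ^ t) (∑-longBorders≤ k _ b 2≤k (m≤n+m b m)))
                    (∑-longBorders≤ k _ (t + b) 2≤k (m≤n+m (t + b) m)) ⟩
      k ^ t * k ^ b + k ^ (t + b)
        ≡⟨ cong₂ _+_ (sym (^-distribˡ-+-* k t b)) (sym (+-identityʳ _)) ⟩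
      2 * k ^ (t + b)
        ∎
      where open ≤-Reasoning

    ∑-within : (f g : Word k → ℕ) → (∀ {w} → w ∈ W → f w ≤ g w + errors w) →
               ∑ W f ≤ ∑ W g + 2 * k ^ (t + b)
    ∑-within f g f≤ = begin
      ∑ W f                          ≤⟨ ∑-mono W f≤ ⟩
      ∑ W (λ w → g w + errors w)     ≡⟨ ∑-+ W g errors ⟩
      ∑ W g + ∑ W errors             ≤⟨ +-monoʳ-≤ (∑ W g) ∑-errors≤ ⟩
      ∑ W g + 2 * k ^ (t + b)        ∎
      where open ≤-Reasoning

    ∑-cut : ∑ W (unique ∘ cut m t) ≡ k ^ t * B k (m + b)
    ∑-cut = trans (∑-words-cut m t b unique) (cong (k ^ t *_) (sym (B≡∑ k (m + b))))

    module Split {w : Word k} (|w| : length w ≡ m + (t + b)) where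
      p = take m w
      y = take t (drop m w)
      s = drop t (drop m w)

      rejoin : p ++ y ++ s ≡ w
      rejoin = trans (cong (p ++_) (List.take++drop≡id t (drop m w))) (List.take++drop≡id m w)

      |p| : length p ≡ m
      |p| = trans (List.length-take m w) (trans (cong (m ⊓_) |w|) (m≤n⇒m⊓n≡m (m≤m+n m _)))

      |ys| : length (y ++ s) ≡ t + b
      |ys| = trans (cong length (List.take++drop≡id t (drop m w)))
               (trans (List.length-drop m w) (trans (cong (_∸ m) |w|) (m+n∸m≡n m _)))

      |s| : length s ≡ b
      |s| = trans (List.length-drop t (drop m w)) (trans (cong (_∸ t)
              (trans (List.length-drop m w) (trans (cong (_∸ m) |w|) (m+n∸m≡n m _)))) (m+n∸m≡n t b))

      p≤s : length p ≤ length s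
      p≤s = subst₂ _≤_ (sym |p|) (sym |s|) m≤b

    -- The cut word is `p ++ [] ++ s` and `w` is `p ++ y ++ s`, so `unique-transfer` compares them
    -- with one middle empty.
    unique-cut≤ : ∀ {w} → w ∈ W → unique (cut m t w) ≤ unique w + errors w
    unique-cut≤ {w} w∈ = subst₂ (λ e e′ → unique (cut m t w) ≤
          unique w + (longBorders e (cut m t w) + longBorders e′ w)) |s| |ys|
        (subst (λ v → unique (cut m t w) ≤
          unique v + (longBorders (length s) (cut m t w) + longBorders (length (y ++ s)) v)) rejoin
          (unique-transfer p s [] y p≤s))
      where open Split {w} (∈-words⇒length _ w∈)

    unique≤cut : ∀ {w} → w ∈ W → unique w ≤ unique (cut m t w) + errors w
    unique≤cut {w} w∈ = subst₂ (λ e e′ → unique w ≤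
          unique (cut m t w) + (longBorders e (cut m t w) + longBorders e′ w)) |s| |ys|
        (subst (λ v → unique v ≤
          unique (cut m t w) + (longBorders (length s) (cut m t w) + longBorders (length (y ++ s)) v)) rejoin
          (≤-trans (unique-transfer p s y [] p≤s)
            -- Exchanging the two middles also exchanges the two error terms.
            (+-monoʳ-≤ (unique (p ++ s)) (≤-reflexive (+-comm (longBorders (length (y ++ s)) (p ++ y ++ s)) _)))))
      where open Split {w} (∈-words⇒length _ w∈)

  -- Divided by `k ^ (m + (t + b))`, this and `B-extend-upper` say that the two probabilities differ
  -- by at most `2 / k ^ m`, whatever `t` and `b` are.
  B-extend-lower : k ^ t * B k (m + b) ≤ B k (m + (t + b)) + 2 * k ^ (t + b)
  B-extend-lower = subst₂ (λ a c → a ≤ c + 2 * k ^ (t + b)) ∑-cut (sym (B≡∑ k (m + (t + b))))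
    (∑-within (unique ∘ cut m t) unique unique-cut≤)

  B-extend-upper : B k (m + (t + b)) ≤ k ^ t * B k (m + b) + 2 * k ^ (t + b)
  B-extend-upper = subst₂ (λ a c → a ≤ c + 2 * k ^ (t + b)) (sym (B≡∑ k (m + (t + b)))) ∑-cut
    (∑-within unique (unique ∘ cut m t) unique≤cut)

-- Inequalities between fractions, and an exponential bound.

/-≤-+ : ∀ a c {b d e} .{{_ : NonZero b}} .{{_ : NonZero d}} .{{_ : NonZero e}} →
  a * d * e ≤ (c * e + d) * b → ℤ.+ a / b ℚ.≤ ℤ.+ c / d ℚ.+ ℤ.+ 1 / e
/-≤-+ a c {b@(suc b-1)} {d@(suc d-1)} {e@(suc e-1)} ade≤ = ℚ.toℚᵘ-cancel-≤ (begin
  ℚ.toℚᵘ (ℤ.+ a / b)                              ≃⟨ ℚ.toℚᵘ-fromℚᵘ (mkℚᵘ (ℤ.+ a) b-1) ⟩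
  mkℚᵘ (ℤ.+ a) b-1                                ≤⟨ *≤* num≤ ⟩
  mkℚᵘ (ℤ.+ c) d-1 ℚᵘ.+ mkℚᵘ (ℤ.+ 1) e-1          ≃⟨ ℚᵘ.+-cong (ℚ.toℚᵘ-fromℚᵘ (mkℚᵘ (ℤ.+ c) d-1))
                                                               (ℚ.toℚᵘ-fromℚᵘ (mkℚᵘ (ℤ.+ 1) e-1)) ⟨
  ℚ.toℚᵘ (ℤ.+ c / d) ℚᵘ.+ ℚ.toℚᵘ (ℤ.+ 1 / e)      ≃⟨ ℚ.toℚᵘ-homo-+ (ℤ.+ c / d) (ℤ.+ 1 / e) ⟨
  ℚ.toℚᵘ (ℤ.+ c / d ℚ.+ ℤ.+ 1 / e)                ∎)
  where
  open ℚᵘ.≤-Reasoning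
  -- Cross-multiplication, with the right side written as `(c * e + d) / (d * e)`. Unnormalised
  -- rationals keep these denominators, whereas `_/_` reduces to lowest terms.
  num≤ : ℤ.+ a ℤ.* ℤ.+ (d * e) ℤ.≤ (ℤ.+ c ℤ.* ℤ.+ e ℤ.+ ℤ.+ 1 ℤ.* ℤ.+ d) ℤ.* ℤ.+ b
  num≤ = subst₂ ℤ._≤_
    (trans (cong ℤ.+_ (*-assoc a d e)) (ℤ.pos-* a (d * e)))
    (trans (ℤ.pos-* (c * e + d) b) (cong (ℤ._* ℤ.+ b)
      (cong₂ ℤ._+_ (ℤ.pos-* c e) (sym (ℤ.*-identityˡ (ℤ.+ d))))))
    (ℤ.+≤+ ade≤)

∣p-q∣-comm : ∀ x y → ℚ.∣ x ℚ.- y ∣ ≡ ℚ.∣ y ℚ.- x ∣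
∣p-q∣-comm x y = trans (sym (ℚ.∣-p∣≡∣p∣ (x ℚ.- y))) (cong ℚ.∣_∣ (⁻¹-anti-homo-// ℚ.+-0-group x y))

p≤q+r⇒p-q≤r : ∀ {p q r} → p ℚ.≤ q ℚ.+ r → p ℚ.- q ℚ.≤ r
p≤q+r⇒p-q≤r {p} {q} {r} p≤q+r = subst (p ℚ.- q ℚ.≤_) (xyx⁻¹≈y ℚ.+-0-abelianGroup q r)
  (ℚ.+-monoˡ-≤ (ℚ.- q) p≤q+r)

∣p-q∣≤ : ∀ {x y z} → x ℚ.≤ y ℚ.+ z → y ℚ.≤ x ℚ.+ z → ℚ.∣ x ℚ.- y ∣ ℚ.≤ z
∣p-q∣≤ {x} {y} {z} x≤ y≤ with ℚ.∣p∣≡p∨∣p∣≡-p (x ℚ.- y)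
... | inj₁ eq = subst (ℚ._≤ z) (sym eq) (p≤q+r⇒p-q≤r x≤)
... | inj₂ eq = subst (ℚ._≤ z) (sym (trans eq (⁻¹-anti-homo-// ℚ.+-0-group x y))) (p≤q+r⇒p-q≤r y≤)

-- Turns the exponential error `2 / k ^ m` into the bound `1 / m` demanded of a regular sequence.
2*[1+n]≤k^[1+n] : ∀ {k} → 2 ≤ k → ∀ n → 2 * suc n ≤ k ^ suc n
2*[1+n]≤k^[1+n] {k} 2≤k zero    = ≤-trans 2≤k (≤-reflexive (sym (*-identityʳ k)))
2*[1+n]≤k^[1+n] {k} 2≤k (suc n) = begin
  2 * suc (suc n)              ≤⟨ *-monoʳ-≤ 2 (s≤s (m≤m+n (suc n) _)) ⟩
  2 * (suc (suc n + (n + 0)))  ≡⟨ cong (2 *_) (sym (+-suc (suc n) (n + 0))) ⟩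
  2 * (2 * suc n)              ≤⟨ *-mono-≤ 2≤k (2*[1+n]≤k^[1+n] 2≤k n) ⟩
  k ^ suc (suc n)              ∎
  where open ≤-Reasoning

-- The Cauchy estimate for the probabilities.

module _ (k : ℕ) .{{_ : NonZero k}} (2≤k : 2 ≤ k) where

  private
    swap : ∀ m t b → m + (t + b) ≡ t + (m + b)
    swap = solve-∀

    module Extension {j b : ℕ} (m≤b : suc j ≤ b) (t : ℕ) where

      m n n′ K E : ℕ
      m  = suc j
      n  = m + b
      n′ = m + (t + b)
      K  = k ^ t
      E  = k ^ (t + b)

      k^n′≡k^m*E : k ^ n′ ≡ k ^ m * E
      k^n′≡k^m*E = ^-distribˡ-+-* k m (t + b)

      k^n′≡K*k^n : k ^ n′ ≡ K * k ^ n
      k^n′≡K*k^n = trans (cong (k ^_) (swap m t b)) (^-distribˡ-+-* k t n)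

      -- Since `k ^ n′` is `k ^ m * E`, this is `2 / k ^ m ≤ 1 / m` with denominators cleared.
      2m*E≤k^n′ : 2 * m * E ≤ k ^ n′
      2m*E≤k^n′ = ≤-trans (*-monoˡ-≤ E (2*[1+n]≤k^[1+n] 2≤k j)) (≤-reflexive (sym k^n′≡k^m*E))

      lower : P k n ℚ.≤ P k n′ ℚ.+ ℤ.+ 1 / m
      lower = /-≤-+ (B k n) (B k n′) {{m^n≢0 k n}} {{m^n≢0 k n′}} (begin
        B k n * k ^ n′ * m
          -- Splitting `K` off the larger power produces `K * B k n`, the quantity that
          -- `B-extend-lower` bounds.
          ≡⟨ cong (λ x → B k n * x * m) k^n′≡K*k^n ⟩
        B k n * (K * k ^ n) * m
          ≡⟨ rearrange₁ (B k n) K (k ^ n) m ⟩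
        K * B k n * (m * k ^ n)
          ≤⟨ *-monoˡ-≤ (m * k ^ n) (B-extend-lower k 2≤k m≤b t) ⟩
        (B k n′ + 2 * E) * (m * k ^ n)
          ≡⟨ *-assoc (B k n′ + 2 * E) m (k ^ n) ⟨
        (B k n′ + 2 * E) * m * k ^ n
          ≡⟨ cong (_* k ^ n) (*-distribʳ-+ m (B k n′) (2 * E)) ⟩
        (B k n′ * m + 2 * E * m) * k ^ n
          ≡⟨ cong (λ x → (B k n′ * m + x) * k ^ n) (rearrange₂ 2 E m) ⟩
        (B k n′ * m + 2 * m * E) * k ^ n
          ≤⟨ *-monoˡ-≤ (k ^ n) (+-monoʳ-≤ (B k n′ * m) 2m*E≤k^n′) ⟩
        (B k n′ * m + k ^ n′) * k ^ n
          ∎)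
        where
        open ≤-Reasoning
        rearrange₁ : ∀ a K N m → a * (K * N) * m ≡ K * a * (m * N)
        rearrange₁ = solve-∀
        rearrange₂ : ∀ c E m → c * E * m ≡ c * m * E
        rearrange₂ = solve-∀

      upper : P k n′ ℚ.≤ P k n ℚ.+ ℤ.+ 1 / m
      upper = /-≤-+ (B k n′) (B k n) {{m^n≢0 k n′}} {{m^n≢0 k n}} (begin
        B k n′ * k ^ n * m
          ≤⟨ *-monoˡ-≤ m (*-monoˡ-≤ (k ^ n) (B-extend-upper k 2≤k m≤b t)) ⟩
        (K * B k n + 2 * E) * k ^ n * m
          ≡⟨ cong (_* m) (*-distribʳ-+ (k ^ n) (K * B k n) (2 * E)) ⟩
        (K * B k n * k ^ n + 2 * E * k ^ n) * m
          ≡⟨ *-distribʳ-+ m (K * B k n * k ^ n) (2 * E * k ^ n) ⟩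
        K * B k n * k ^ n * m + 2 * E * k ^ n * m
          ≡⟨ cong₂ _+_ (rearrange₁ (B k n) K (k ^ n) m) (rearrange₂ 2 E (k ^ n) m) ⟩
        B k n * m * (K * k ^ n) + k ^ n * (2 * m * E)
          ≤⟨ +-mono-≤ (≤-reflexive (cong (B k n * m *_) (sym k^n′≡K*k^n)))
                      (*-monoʳ-≤ (k ^ n) 2m*E≤k^n′) ⟩
        B k n * m * k ^ n′ + k ^ n * k ^ n′
          ≡⟨ *-distribʳ-+ (k ^ n′) (B k n * m) (k ^ n) ⟨
        (B k n * m + k ^ n) * k ^ n′
          ∎)
        where
        open ≤-Reasoning
        rearrange₁ : ∀ a K N m → K * a * N * m ≡ a * m * (K * N)
        rearrange₁ = solve-∀
        rearrange₂ : ∀ c E N m → c * E * N * m ≡ N * (c * m * E)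
        rearrange₂ = solve-∀

  -- As `n` is at least `2 * m`, setting aside `m` letters in front leaves a tail of length `b` at
  -- least `m`. The longer words arise by inserting `n′ ∸ n` letters between the two.
  P-cauchy : ∀ j n n′ → 2 * suc j ≤ n → n ≤ n′ → ℚ.∣ P k n ℚ.- P k n′ ∣ ℚ.≤ ℤ.+ 1 / suc j
  P-cauchy j n n′ 2m≤n n≤n′ =
    subst₂ (λ a c → ℚ.∣ P k a ℚ.- P k c ∣ ℚ.≤ ℤ.+ 1 / m) n≡ n′≡
      (∣p-q∣≤ (Extension.lower m≤b t) (Extension.upper m≤b t))
    where
    m = suc j
    b = n ∸ m
    t = n′ ∸ n
    m+m≤n : m + m ≤ n
    m+m≤n = ≤-trans (≤-reflexive (cong (m +_) (sym (+-identityʳ m)))) 2m≤n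
    m≤b : m ≤ b
    m≤b = ≤-trans (≤-reflexive (sym (m+n∸m≡n m m))) (∸-monoˡ-≤ m m+m≤n)
    n≡ : m + b ≡ n
    n≡ = m+[n∸m]≡n (m+n≤o⇒m≤o m m+m≤n)
    n′≡ : m + (t + b) ≡ n′
    n′≡ = trans (swap m t b) (trans (cong (_+_ t) n≡) (m∸n+n≡m n≤n′))

-- From an explicit Cauchy modulus to a Bishop real.

1/-nonNeg : ∀ j → ℚ.0ℚ ℚ.≤ ℤ.+ 1 / suc j
1/-nonNeg j = ℚ.nonNegative⁻¹ (ℤ.+ 1 / suc j) {{ℚ.normalize-nonNeg 1 (suc j)}}

-- The denominator of `ε` serves as `suc j`, because the numerator is at least 1.
positive⇒1/≤ : ∀ ε → ℚ.Positive ε → ∃ λ j → ℤ.+ 1 / suc j ℚ.≤ ε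
positive⇒1/≤ ε@(mkℚ (ℤ.+ suc p) d-1 _) _ = d-1 , ℚ.toℚᵘ-cancel-≤ (begin
  ℚ.toℚᵘ (ℤ.+ 1 / suc d-1)     ≃⟨ ℚ.toℚᵘ-fromℚᵘ (mkℚᵘ (ℤ.+ 1) d-1) ⟩
  mkℚᵘ (ℤ.+ 1) d-1             ≤⟨ *≤* (ℤ.*-monoʳ-≤-nonNeg (ℤ.+ suc d-1) (ℤ.+≤+ (s≤s (z≤n {p})))) ⟩
  ℚ.toℚᵘ ε                     ∎)
  where open ℚᵘ.≤-Reasoning

module _ (a : ℕ → ℚ)
  (a-cauchy : ∀ j n n′ → 2 * suc j ≤ n → n ≤ n′ → ℚ.∣ a n ℚ.- a n′ ∣ ℚ.≤ ℤ.+ 1 / suc j) where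

  private
    a-cauchy-sym : ∀ j n n′ → 2 * suc j ≤ n → 2 * suc j ≤ n′ →
      ℚ.∣ a n ℚ.- a n′ ∣ ℚ.≤ ℤ.+ 1 / suc j
    a-cauchy-sym j n n′ ≤n ≤n′ = [ a-cauchy j n n′ ≤n
                                 , subst (ℚ._≤ ℤ.+ 1 / suc j) (∣p-q∣-comm (a n′) (a n))
                                     ∘ a-cauchy j n′ n ≤n′
                                 ]′ (≤-total n n′)

    2*suc-mono : ∀ {i j} → i ≤ j → 2 * suc i ≤ 2 * suc j
    2*suc-mono i≤j = *-monoʳ-≤ 2 (s≤s i≤j)

    -- One estimate for both regularity and convergence. Both indices pass the threshold of the
    -- smaller of `i` and `j`, so one summand alone bounds the difference, and the other is
    -- non-negative.
    close : ∀ i j n n′ ε → 2 * suc i ≤ n → 2 * suc j ≤ n′ → ℤ.+ 1 / suc i ℚ.≤ ε →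
      ℚ.∣ a n ℚ.- a n′ ∣ ℚ.≤ ε ℚ.+ ℤ.+ 1 / suc j
    close i j n n′ ε ≤n ≤n′ 1/i≤ε = [ bound-by-ε , bound-by-1/j ]′ (≤-total i j)
      where
      open ℚ.≤-Reasoning
      bound-by-ε : i ≤ j → ℚ.∣ a n ℚ.- a n′ ∣ ℚ.≤ ε ℚ.+ ℤ.+ 1 / suc j
      bound-by-ε i≤j = begin
        ℚ.∣ a n ℚ.- a n′ ∣     ≤⟨ a-cauchy-sym i n n′ ≤n (≤-trans (2*suc-mono i≤j) ≤n′) ⟩
        ℤ.+ 1 / suc i          ≤⟨ 1/i≤ε ⟩
        ε                      ≡⟨ ℚ.+-identityʳ ε ⟨
        ε ℚ.+ ℚ.0ℚ             ≤⟨ ℚ.+-monoʳ-≤ ε (1/-nonNeg j) ⟩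
        ε ℚ.+ ℤ.+ 1 / suc j    ∎
      bound-by-1/j : j ≤ i → ℚ.∣ a n ℚ.- a n′ ∣ ℚ.≤ ε ℚ.+ ℤ.+ 1 / suc j
      bound-by-1/j j≤i = begin
        ℚ.∣ a n ℚ.- a n′ ∣     ≤⟨ a-cauchy-sym j n n′ (≤-trans (2*suc-mono j≤i) ≤n) ≤n′ ⟩
        ℤ.+ 1 / suc j          ≡⟨ ℚ.+-identityˡ (ℤ.+ 1 / suc j) ⟨
        ℚ.0ℚ ℚ.+ ℤ.+ 1 / suc j ≤⟨ ℚ.+-monoˡ-≤ (ℤ.+ 1 / suc j) (ℚ.≤-trans (1/-nonNeg i) 1/i≤ε) ⟩
        ε ℚ.+ ℤ.+ 1 / suc j    ∎

  cauchy⇒converges : ∃ λ (L : ℝ) → ConvergesTo a L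
  cauchy⇒converges = L , converges
    where
    L : ℝ
    L = record
      -- The index is the first one at which the modulus guarantees tolerance `1 / suc j`.
      { approx  = λ j → a (2 * suc j)
      ; regular = λ i j → close i j (2 * suc i) (2 * suc j) (ℤ.+ 1 / suc i) ≤-refl ≤-refl ℚ.≤-refl
      }

    converges : ConvergesTo a L
    converges ε ε>0 =
      let i , 1/i≤ε = positive⇒1/≤ ε ε>0
      -- The threshold depends on `ε` only; each approximation of `L` sits exactly at its own
      -- threshold, hence `≤-refl`.
      in 2 * suc i , λ n n≥ j → close i j n (2 * suc j) ε n≥ ≤-refl 1/i≤ε

theorem12 : (k : ℕ) .{{_ : NonZero k}} → 2 ≤ k → ∃ λ (L : ℝ) → ConvergesTo (P k) L
theorem12 k 2≤k = cauchy⇒converges (P k) (P-cauchy k 2≤k)
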